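{- Let $\mathbf{M}$ be a Markov chain with $n$ states. Given an $\ell_1$ distance tester with time complexity $T(n,\epsilon,\delta)$ and gap $f$, and an oracle next_node for $\mathbf{M}$, there exists a test (taking parameters $t,\epsilon,\delta$) with time complexity $O(n\,t\cdot T(n,\epsilon,\delta/n))$ and the following behavior: if $\mathbf{M}$ is $(f(\epsilon)/2,t)$-mixing then $\Pr[\mathbf{M}\text{ is accepted}]>1-\delta$; if $\mathbf{M}$ is not $(\epsilon,t)$-mixing then $\Pr[\mathbf{M}\text{ is accepted}]<\delta$.
   Context: A Markov chain on $n$ states is represented by its $n\times n$ transition probability matrix $\mathbf{M}$. For a state $u$, $\mathbf{e}_u$ is the row vector with a one in position $u$ and zeros elsewhere, so $\mathbf{e}_u\mathbf{M}^t$ is the distribution of the endpoint of a $t$-step random walk started at $u$. $\|\mathbf{v}\|_1=\sum_i|v_i|$. The chain $\mathbf{M}$ is $(\epsilon,t)$-mixing if there exists a distribution $\mathbf{s}$ such that $\|\mathbf{e}_u\mathbf{M}^t-\mathbf{s}\|_1\le\epsilon$ for all states $u$. The oracle next_node, on input a state $u$, responds at unit cost with a state $v$ with probability $\mathbf{M}(u,v)$ (independently across calls). An $\ell_1$ distance tester with gap $f$ and time complexity $T(n,\epsilon,\delta)$ is a randomized algorithm which, given parameters $\epsilon,\delta$ and oracle (sample) access to two distributions over the same $n$-element set, runs in time $T(n,\epsilon,\delta)$ (each sample counted at unit cost) and decides with confidence $1-\delta$ whether their $\ell_1$ distance is at most $f(\epsilon)$ (in which case it accepts) or more than $\epsilon$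 (in which case it rejects). -}

module Defs where

open import Algebra.Bundles using (CommutativeRing)
open import Data.Bool.Base using (Bool; true; false; if_then_else_)
open import Data.Empty using (⊥)
open import Data.Fin.Base using (Fin; toℕ; fromℕ<)
import Data.Fin.Properties as Fin
open import Data.List.Base using (List; []; _∷_; _∷ʳ_; length)
open import Data.Maybe.Base using (Maybe; just; nothing; maybe′)
open import Data.Nat.Base as ℕ using (ℕ; zero; suc)
import Data.Nat.Properties as ℕ
open import Data.Product.Base using (_×_; ∃-syntax)
open import Data.Unit.Base using (⊤)
open import Data.Vec.Base using (Vec; []; _∷_; lookup)
open import Data.Vec.Functional using (Vector)
open import Level using (_⊔_) renaming (suc to lsuc)
open import Relation.Binary.Core using (Rel)
import Relation.Binary.Construct.NonStrictToStrict as NonStrictToStrict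
open import Relation.Binary.Structures using (IsDecTotalOrder)
open import Relation.Nullary using (¬_; Dec; yes; no; does)

-- Stands in for the real numbers, which the standard library does not have.
-- The inverse is total; its value at zero is unspecified.

record OrderedField c ℓ₁ ℓ₂ : Set (lsuc (c ⊔ ℓ₁ ⊔ ℓ₂)) where
  infix  8 _⁻¹
  infixl 7 _/_
  infix  4 _≤_
  field
    commutativeRing : CommutativeRing c ℓ₁

  open CommutativeRing commutativeRing public

  field
    _≤_             : Rel Carrier ℓ₂
    _⁻¹             : Carrier → Carrier
    isDecTotalOrder : IsDecTotalOrder _≈_ _≤_
    +-monoˡ-≤       : ∀ {x y} z → x ≤ y → x + z ≤ y + z
    *-nonNeg        : ∀ {x y} → 0# ≤ x → 0# ≤ y → 0# ≤ x * y
    0≉1             : ¬ (0# ≈ 1#)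
    ⁻¹-inverseʳ     : ∀ {x} → ¬ (x ≈ 0#) → x * x ⁻¹ ≈ 1#

  open IsDecTotalOrder isDecTotalOrder public using (_≤?_)
  open NonStrictToStrict _≈_ _≤_ public using (_<_)
  open import Algebra.Properties.Semiring.Sum semiring public using (sum)
  open import Algebra.Properties.Semiring.Mult semiring using () renaming (_×_ to _·_)

  _/_ : Carrier → Carrier → Carrier
  x / y = x * y ⁻¹

  fromℕ : ℕ → Carrier
  fromℕ n = n · 1#

  ∣_∣ : Carrier → Carrier
  ∣ x ∣ = if does (0# ≤? x) then x else - x

module Chains {c ℓ₁ ℓ₂} (F : OrderedField c ℓ₁ ℓ₂) where
  open OrderedField F

  Matrix : ℕ → Set c
  Matrix n = Fin n → Vector Carrier n

  ‖_‖₁ : ∀ {n} → Vector Carrier n → Carrier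
  ‖ v ‖₁ = sum (λ i → ∣ v i ∣)

  infixl 6 _⊖_
  _⊖_ : ∀ {n} → Vector Carrier n → Vector Carrier n → Vector Carrier n
  (v ⊖ w) i = v i - w i

  unit : ∀ {n} → Fin n → Vector Carrier n
  unit u i = if does (u Fin.≟ i) then 1# else 0#

  infixl 7 _⊡_
  _⊡_ : ∀ {n} → Vector Carrier n → Matrix n → Vector Carrier n
  (v ⊡ M) j = sum (λ i → v i * M i j)

  infixr 8 _^_
  _^_ : ∀ {n} → Matrix n → ℕ → Matrix n
  M ^ zero  = unit
  M ^ suc t = λ u → (M ^ t) u ⊡ M

  IsDistribution : ∀ {n} → Vector Carrier n → Set (ℓ₁ ⊔ ℓ₂)
  IsDistribution p = (∀ i → 0# ≤ p i) × (sum p ≈ 1#)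

  IsMarkovChain : ∀ {n} → Matrix n → Set (ℓ₁ ⊔ ℓ₂)
  IsMarkovChain M = ∀ u → IsDistribution (M u)

  Mixing : ∀ {n} → Matrix n → Carrier → ℕ → Set (c ⊔ ℓ₁ ⊔ ℓ₂)
  Mixing M ε t = ∃[ s ] IsDistribution s × (∀ u → ‖ unit u ⊡ M ^ t ⊖ s ‖₁ ≤ ε)

-- The model of computation is an untyped call-by-value λ-calculus with exact
-- scalar arithmetic, random choice and an addressable memory.  Programs contain
-- neither scalars nor oracles: they receive both as values of free variables.

data Op₁ : Set where
  fst snd  : Op₁
  toScalar : Op₁
  random   : Op₁    -- uniform on {0,…,m-1} for an argument m > 0
  new      : Op₁    -- appends a memory cell with the given contents
  read     : Op₁

data Op₂ : Set where
  pair                                    : Op₂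
  addℕ monusℕ mulℕ leqℕ                   : Op₂
  addScalar subScalar mulScalar divScalar : Op₂
  leqScalar                               : Op₂
  shift                                   : Op₂    -- address + offset
  write                                   : Op₂    -- returns the written value

data Program (k : ℕ) : Set where
  var  : Fin k → Program k
  nat  : ℕ → Program k
  bool : Bool → Program k
  -- variable 0 is the argument, variable 1 the function itself
  fun  : Program (suc (suc k)) → Program k
  app  : Program k → Program k → Program k
  op₁  : Op₁ → Program k → Program k
  op₂  : Op₂ → Program k → Program k → Program k
  cond : Program k → Program k → Program k → Program k

readAt : ∀ {a} {A : Set a} → List A → ℕ → Maybe A
readAt []       _       = nothing
readAt (x ∷ _)  zero    = just x
readAt (_ ∷ xs) (suc a) = readAt xs a

writeAt : ∀ {a} {A : Set a} → List A → ℕ → A → Maybe (List A)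
writeAt []       _       _ = nothing
writeAt (_ ∷ xs) zero    y = just (y ∷ xs)
writeAt (x ∷ xs) (suc a) y = maybe′ (λ ys → just (x ∷ ys)) nothing (writeAt xs a y)

module Machine {c ℓ₁ ℓ₂} (F : OrderedField c ℓ₁ ℓ₂) where
  open OrderedField F
  open Chains F

  data Value : Set c where
    nat     : ℕ → Value
    bool    : Bool → Value
    scalar  : Carrier → Value
    pair    : Value → Value → Value
    address : ℕ → Value
    closure : ∀ {k} → Program (suc (suc k)) → Vec Value k → Value
    -- oracles; the i-th element of Fin n is represented by nat (toℕ i)
    sampler   : ∀ {n} → Vector Carrier n → Value
    next-node : ∀ {n} → Matrix n → Value

  Env : ℕ → Set c
  Env k = Vec Value k

  Memory : Set c
  Memory = List Value

  data Frame : Set c where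
    appˡ : ∀ {k} → Program k → Env k → Frame
    appʳ : Value → Frame
    op₁  : Op₁ → Frame
    op₂ˡ : ∀ {k} → Op₂ → Program k → Env k → Frame
    op₂ʳ : Op₂ → Value → Frame
    cond : ∀ {k} → Program k → Program k → Env k → Frame

  Stack : Set c
  Stack = List Frame

  data Config : Set c where
    eval   : ∀ {k} → Program k → Env k → Stack → Memory → Config
    return : Value → Stack → Memory → Config

  data Step : Set c where
    halt   : Value → Step
    stuck  : Step
    goto   : Config → Step
    choose : ∀ {n} → Vector Carrier n → (Fin n → Config) → Step

  draw : ∀ {n} → Vector Carrier n → Stack → Memory → Step
  draw p K μ = choose p (λ i → return (nat (toℕ i)) K μ)

  drawNext : ∀ {n u} → Matrix n → Dec (u ℕ.< n) → Stack → Memory → Step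
  drawNext M (yes u<n) K μ = draw (M (fromℕ< u<n)) K μ
  drawNext M (no _)    K μ = stuck

  -- A sampler ignores its argument.
  apply : Value → Value → Stack → Memory → Step
  apply (closure e ρ)     v       K μ = goto (eval e (v ∷ closure e ρ ∷ ρ) K μ)
  apply (sampler p)       v       K μ = draw p K μ
  apply (next-node {n} M) (nat u) K μ = drawNext M (u ℕ.<? n) K μ
  apply _                 _       K μ = stuck

  apply₁ : Op₁ → Value → Stack → Memory → Step
  apply₁ fst      (pair v w)    K μ = goto (return v K μ)
  apply₁ snd      (pair v w)    K μ = goto (return w K μ)
  apply₁ toScalar (nat m)       K μ = goto (return (scalar (fromℕ m)) K μ)
  apply₁ random   (nat (suc m)) K μ = draw {suc m} (λ _ → 1# / fromℕ (suc m)) K μ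
  apply₁ new      v             K μ = goto (return (address (length μ)) K (μ ∷ʳ v))
  apply₁ read     (address a)   K μ = maybe′ (λ v → goto (return v K μ)) stuck (readAt μ a)
  apply₁ _        _             K μ = stuck

  apply₂ : Op₂ → Value → Value → Stack → Memory → Step
  apply₂ pair      v           w          K μ = goto (return (pair v w) K μ)
  apply₂ addℕ      (nat m)     (nat n)    K μ = goto (return (nat (m ℕ.+ n)) K μ)
  apply₂ monusℕ    (nat m)     (nat n)    K μ = goto (return (nat (m ℕ.∸ n)) K μ)
  apply₂ mulℕ      (nat m)     (nat n)    K μ = goto (return (nat (m ℕ.* n)) K μ)
  apply₂ leqℕ      (nat m)     (nat n)    K μ = goto (return (bool (m ℕ.≤ᵇ n)) K μ)
  apply₂ addScalar (scalar x)  (scalar y) K μ = goto (return (scalar (x + y)) K μ)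
  apply₂ subScalar (scalar x)  (scalar y) K μ = goto (return (scalar (x - y)) K μ)
  apply₂ mulScalar (scalar x)  (scalar y) K μ = goto (return (scalar (x * y)) K μ)
  apply₂ divScalar (scalar x)  (scalar y) K μ = goto (return (scalar (x / y)) K μ)
  apply₂ leqScalar (scalar x)  (scalar y) K μ = goto (return (bool (does (x ≤? y))) K μ)
  apply₂ shift     (address a) (nat i)    K μ = goto (return (address (a ℕ.+ i)) K μ)
  apply₂ write     (address a) v          K μ =
    maybe′ (λ μ′ → goto (return v K μ′)) stuck (writeAt μ a v)
  apply₂ _         _           _          K μ = stuck

  step : Config → Step
  step (eval (var x)      ρ K μ) = goto (return (lookup ρ x) K μ)
  step (eval (nat m)      ρ K μ) = goto (return (nat m) K μ)
  step (eval (bool b)     ρ K μ) = goto (return (bool b) K μ)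
  step (eval (fun e)      ρ K μ) = goto (return (closure e ρ) K μ)
  step (eval (app d e)    ρ K μ) = goto (eval d ρ (appˡ e ρ ∷ K) μ)
  step (eval (op₁ o e)    ρ K μ) = goto (eval e ρ (op₁ o ∷ K) μ)
  step (eval (op₂ o d e)  ρ K μ) = goto (eval d ρ (op₂ˡ o e ρ ∷ K) μ)
  step (eval (cond b d e) ρ K μ) = goto (eval b ρ (cond d e ρ ∷ K) μ)
  step (return v            []               μ) = halt v
  step (return v            (appˡ e ρ ∷ K)   μ) = goto (eval e ρ (appʳ v ∷ K) μ)
  step (return v            (appʳ f ∷ K)     μ) = apply f v K μ
  step (return v            (op₁ o ∷ K)      μ) = apply₁ o v K μ
  step (return v            (op₂ˡ o e ρ ∷ K) μ) = goto (eval e ρ (op₂ʳ o v ∷ K) μ)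
  step (return v            (op₂ʳ o w ∷ K)   μ) = apply₂ o w v K μ
  step (return (bool true)  (cond d e ρ ∷ K) μ) = goto (eval d ρ K μ)
  step (return (bool false) (cond d e ρ ∷ K) μ) = goto (eval e ρ K μ)
  step (return _            (cond d e ρ ∷ K) μ) = stuck

  -- DecidesWithin k C: whatever the outcomes of the random choices (oracle
  -- answers included), the machine halts with a Boolean in at most k steps.

  mutual
    DecidesWithin : ℕ → Config → Set
    DecidesWithin zero    C = ⊥
    DecidesWithin (suc k) C = DecidesAfter k (step C)

    DecidesAfter : ℕ → Step → Set
    DecidesAfter k (halt (bool _)) = ⊤
    DecidesAfter k (halt _)        = ⊥
    DecidesAfter k stuck           = ⊥
    DecidesAfter k (goto C)        = DecidesWithin k C
    DecidesAfter k (choose p C)    = ∀ i → DecidesWithin k (C i)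

  -- Pr k C b: probability that the machine halts with output b in at most k
  -- steps.  It is constant in k from any k with DecidesWithin k C onwards.

  outputs : Value → Bool → Carrier
  outputs (bool true)  true  = 1#
  outputs (bool false) false = 1#
  outputs _            _     = 0#

  mutual
    Pr : ℕ → Config → Bool → Carrier
    Pr zero    C b = 0#
    Pr (suc k) C b = PrAfter k (step C) b

    PrAfter : ℕ → Step → Bool → Carrier
    PrAfter k (halt v)     b = outputs v b
    PrAfter k stuck        b = 0#
    PrAfter k (goto C)     b = Pr k C b
    PrAfter k (choose p C) b = sum (λ i → p i * Pr k (C i) b)

  start : ∀ {k} → Program k → Env k → Config
  start P ρ = eval P ρ [] []

module Testing {c ℓ₁ ℓ₂} (F : OrderedField c ℓ₁ ℓ₂) where
  open OrderedField F
  open Chains F public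
  open Machine F public

  runTester : Program 5 → ∀ n (ε δ : Carrier) (p q : Vector Carrier n) → Config
  runTester P n ε δ p q =
    start P (nat n ∷ scalar ε ∷ scalar δ ∷ sampler p ∷ sampler q ∷ [])

  runMixingTest : Program 5 → ∀ {n} → Matrix n → (t : ℕ) (ε δ : Carrier) → Config
  runMixingTest P {n} M t ε δ =
    start P (nat n ∷ nat t ∷ scalar ε ∷ scalar δ ∷ next-node M ∷ [])

  -- Accepting is halting with output true, rejecting with output false.

  record IsL1Tester (f : Carrier → Carrier) (T : ℕ → Carrier → Carrier → ℕ)
                    (P : Program 5) : Set (c ⊔ ℓ₁ ⊔ ℓ₂) where
    field
      decides : ∀ {n ε δ} {p q : Vector Carrier n} → 0# < ε → 0# < δ → δ < 1# →
                IsDistribution p → IsDistribution q →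
                DecidesWithin (T n ε δ) (runTester P n ε δ p q)
      accepts : ∀ {n ε δ} {p q : Vector Carrier n} → 0# < ε → 0# < δ → δ < 1# →
                IsDistribution p → IsDistribution q → ‖ p ⊖ q ‖₁ ≤ f ε →
                1# - δ ≤ Pr (T n ε δ) (runTester P n ε δ p q) true
      rejects : ∀ {n ε δ} {p q : Vector Carrier n} → 0# < ε → 0# < δ → δ < 1# →
                IsDistribution p → IsDistribution q → ε < ‖ p ⊖ q ‖₁ →
                1# - δ ≤ Pr (T n ε δ) (runTester P n ε δ p q) false

-- The test compares, for u = n-1, …, 1, the endpoint distributions of the walks
-- from u and from 0, and accepts if all these n-1 comparisons accept.  If M is
-- (f(ε)/2,t)-mixing, all rows of M ^ t are within f(ε) of row 0 and a union bound
-- gives a failure probability of at most (n-1)δ/n, which is less than δ; if all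
-- rows are within ε of row 0, then row 0 witnesses (ε,t)-mixing, so otherwise
-- some comparison accepts with probability at most δ/n, and n ≥ 2.  The machine
-- part is to show that a tester cannot tell its samplers from t-step walks.

module Submission where

open import Defs
open import Data.Bool.Base using (true; false)
open import Data.Fin.Base using (Fin; zero; suc; toℕ; fromℕ<; lift)
open import Data.Fin.Patterns
import Data.Fin.Properties as Fin
open import Data.List.Base using ([]; _∷_; _∷ʳ_; _++_; length)
import Data.List.Properties as List
open import Data.List.Relation.Binary.Pointwise as List using ([]; _∷_) renaming (Pointwise to Pointwiseᴸ)
open import Data.Maybe.Base as Maybe using (just; nothing)
open import Data.Maybe.Relation.Binary.Pointwise using (just; nothing) renaming (Pointwise to Pointwiseᴹ)
open import Data.Nat.Base as ℕ using (ℕ; zero; suc; NonZero; s≤s; z≤n)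
import Data.Nat.Properties as ℕ
open import Data.Nat.Solver using (module +-*-Solver)
open import Data.Product.Base using (_×_; _,_; proj₁; proj₂; ∃-syntax)
open import Data.Sum.Base using (inj₁; inj₂)
open import Data.Unit.Base using (tt)
open import Data.Vec.Base using ([]; _∷_; lookup)
open import Data.Vec.Functional using (Vector)
open import Function.Base using (_∘_)
open import Level using (_⊔_)
open import Relation.Binary.Bundles using (Poset)
open import Relation.Binary.PropositionalEquality as ≡ using (_≡_)
open import Relation.Binary.Structures using (IsDecTotalOrder)
open import Relation.Nullary using (¬_; yes; no; does; contradiction)
open +-*-Solver using (solve; _:+_; _:*_; _:=_; con)
import Algebra.Properties.Ring
import Relation.Binary.Construct.NonStrictToStrict as NonStrictToStrict
import Relation.Binary.Reasoning.PartialOrder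

-- The tester is an arbitrary untyped program, so its behaviour is accessible only step by step: its
-- run on its own and its run inside the loop are compared by induction on the step bound. The
-- comparison survives because a program can use a function only by applying it, so a closure that
-- walks serves as well as a `sampler`, and because the bound promised for every outcome excludes
-- stuck configurations. No probability space of runs is built. A draw is described by its effect on
-- what follows: if outcome i leads to acceptance with probability `x i`, the draw does so with the
-- `p`-weighted sum of `x`. If the continuation accepts with probability `x` after the tester
-- accepts and with probability 0 after it rejects, the whole accepts with the tester's probability
-- times `x`. Independence of the comparisons never has to be stated. Any tester step might be a
-- sample, so each is charged the cost of an entire walk; this is the origin of the product of t and
-- T in the running time.

-- Arithmetic, absolute values and finite sums in an ordered field.

module OrderedFieldProperties {c ℓ₁ ℓ₂} (F : OrderedField c ℓ₁ ℓ₂) where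
  open OrderedField F hiding (zero)
  open Algebra.Properties.Ring ring
  open IsDecTotalOrder isDecTotalOrder public
    using (antisym; total; isPartialOrder; ≤-respʳ-≈; ≤-respˡ-≈)
    renaming (refl to ≤-refl; reflexive to ≤-reflexive; trans to ≤-trans)
  open NonStrictToStrict _≈_ _≤_ using (<⇒≱)

  poset : Poset c ℓ₁ ℓ₂
  poset = record { isPartialOrder = isPartialOrder }

  open Relation.Binary.Reasoning.PartialOrder poset

  +-mono-≤ : ∀ {x y u v} → x ≤ y → u ≤ v → x + u ≤ y + v
  +-mono-≤ {x} {y} {u} {v} x≤y u≤v = begin
    x + u  ≤⟨ +-monoˡ-≤ u x≤y ⟩
    y + u  ≈⟨ +-comm y u ⟩
    u + y  ≤⟨ +-monoˡ-≤ y u≤v ⟩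
    v + y  ≈⟨ +-comm v y ⟩
    y + v  ∎

  +-cancelʳ-≤ : ∀ {x y} z → x + z ≤ y + z → x ≤ y
  +-cancelʳ-≤ {x} {y} z x+z≤y+z = begin
    x          ≈⟨ //-rightDividesʳ z x ⟨
    x + z - z  ≤⟨ +-monoˡ-≤ (- z) x+z≤y+z ⟩
    y + z - z  ≈⟨ //-rightDividesʳ z y ⟩
    y          ∎

  x≤y⇒0≤y-x : ∀ {x y} → x ≤ y → 0# ≤ y - x
  x≤y⇒0≤y-x {x} {y} x≤y = begin
    0#     ≈⟨ -‿inverseʳ x ⟨
    x - x  ≤⟨ +-monoˡ-≤ (- x) x≤y ⟩
    y - x  ∎

  0≤y-x⇒x≤y : ∀ {x y} → 0# ≤ y - x → x ≤ y
  0≤y-x⇒x≤y {x} {y} 0≤y-x = +-cancelʳ-≤ (- x) (begin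
    x - x  ≈⟨ -‿inverseʳ x ⟩
    0#     ≤⟨ 0≤y-x ⟩
    y - x  ∎)

  x-z≤y⇒x≤y+z : ∀ {x y z} → x - z ≤ y → x ≤ y + z
  x-z≤y⇒x≤y+z {x} {y} {z} x-z≤y = begin
    x          ≈⟨ //-rightDividesˡ z x ⟨
    x - z + z  ≤⟨ +-monoˡ-≤ z x-z≤y ⟩
    y + z      ∎

  x<y+z⇒x-z<y : ∀ {x y z} → x < y + z → x - z < y
  x<y+z⇒x-z<y {x} {y} {z} (x≤y+z , x≉y+z) =
    +-cancelʳ-≤ z (≤-respˡ-≈ (sym (//-rightDividesˡ z x)) x≤y+z) ,
    λ x-z≈y → x≉y+z (trans (sym (//-rightDividesˡ z x)) (+-congʳ x-z≈y))

  x≤x+y : ∀ {x y} → 0# ≤ y → x ≤ x + y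
  x≤x+y {x} {y} 0≤y = begin
    x       ≈⟨ +-identityʳ x ⟨
    x + 0#  ≤⟨ +-mono-≤ ≤-refl 0≤y ⟩
    x + y   ∎

  x<x+y : ∀ {x y} → 0# < y → x < x + y
  x<x+y {x} {y} (0≤y , 0≉y) = x≤x+y 0≤y ,
    λ x≈x+y → 0≉y (sym (+-identityʳ-unique x y (sym x≈x+y)))

  neg-antimono-≤ : ∀ {x y} → x ≤ y → - y ≤ - x
  neg-antimono-≤ {x} {y} x≤y = 0≤y-x⇒x≤y (begin
    0#         ≤⟨ x≤y⇒0≤y-x x≤y ⟩
    y - x      ≈⟨ +-comm y (- x) ⟩
    - x + y    ≈⟨ +-congˡ (-‿involutive y) ⟨
    - x - - y  ∎)

  *-monoˡ-≤ : ∀ {x y} z → 0# ≤ z → x ≤ y → z * x ≤ z * y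
  *-monoˡ-≤ {x} {y} z 0≤z x≤y = 0≤y-x⇒x≤y (begin
    0#             ≤⟨ *-nonNeg 0≤z (x≤y⇒0≤y-x x≤y) ⟩
    z * (y - x)    ≈⟨ x[y-z]≈xy-xz z y x ⟩
    z * y - z * x  ∎)

  *-monoʳ-≤ : ∀ {x y} z → 0# ≤ z → x ≤ y → x * z ≤ y * z
  *-monoʳ-≤ {x} {y} z 0≤z x≤y = begin
    x * z  ≈⟨ *-comm x z ⟩
    z * x  ≤⟨ *-monoˡ-≤ z 0≤z x≤y ⟩
    z * y  ≈⟨ *-comm z y ⟩
    y * z  ∎

  0≤1 : 0# ≤ 1#
  0≤1 with total 0# 1#
  ... | inj₁ 0≤1 = 0≤1
  ... | inj₂ 1≤0 = begin
    0#             ≤⟨ *-nonNeg 0≤-1 0≤-1 ⟩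
    - 1# * - 1#    ≈⟨ -1*x≈-x (- 1#) ⟩
    - - 1#         ≈⟨ -‿involutive 1# ⟩
    1#             ∎
    where
    0≤-1 : 0# ≤ - 1#
    0≤-1 = begin
      0#    ≈⟨ -0#≈0# ⟨
      - 0#  ≤⟨ neg-antimono-≤ 1≤0 ⟩
      - 1#  ∎

  0≤fromℕ : ∀ n → 0# ≤ fromℕ n
  0≤fromℕ zero    = ≤-refl
  0≤fromℕ (suc n) = ≤-trans 0≤1 (x≤x+y (0≤fromℕ n))

  0<fromℕ[1+n] : ∀ n → 0# < fromℕ (suc n)
  0<fromℕ[1+n] n = begin-strict
    0#             <⟨ 0≤1 , 0≉1 ⟩
    1#             ≤⟨ x≤x+y (0≤fromℕ n) ⟩
    fromℕ (suc n)  ∎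

  x/y*y≈x : ∀ x {y} → 0# < y → x / y * y ≈ x
  x/y*y≈x x {y} (_ , 0≉y) = begin-equality
    x * y ⁻¹ * y    ≈⟨ *-assoc x (y ⁻¹) y ⟩
    x * (y ⁻¹ * y)  ≈⟨ *-congˡ (*-comm (y ⁻¹) y) ⟩
    x * (y * y ⁻¹)  ≈⟨ *-congˡ (⁻¹-inverseʳ (0≉y ∘ sym)) ⟩
    x * 1#          ≈⟨ *-identityʳ x ⟩
    x               ∎

  0<x/y : ∀ {x y} → 0# < x → 0# < y → 0# < x / y
  0<x/y {x} {y} 0<x@(0≤x , 0≉x) 0<y@(0≤y , _) = 0≤x/y , λ 0≈x/y → 0≉x (begin-equality
    0#         ≈⟨ zeroˡ y ⟨
    0# * y     ≈⟨ *-congʳ 0≈x/y ⟩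
    x / y * y  ≈⟨ x/y*y≈x x 0<y ⟩
    x          ∎)
    where
    0≤x/y : 0# ≤ x / y
    0≤x/y with total 0# (x / y)
    ... | inj₁ 0≤x/y = 0≤x/y
    ... | inj₂ x/y≤0 = contradiction x≤0 (<⇒≱ antisym 0<x)
      where
      x≤0 : x ≤ 0#
      x≤0 = begin
        x          ≈⟨ x/y*y≈x x 0<y ⟨
        x / y * y  ≤⟨ *-monoʳ-≤ y 0≤y x/y≤0 ⟩
        0# * y     ≈⟨ zeroˡ y ⟩
        0#         ∎

  0<fromℕ : ∀ {n} → 0 ℕ.< n → 0# < fromℕ n
  0<fromℕ {suc n} _ = 0<fromℕ[1+n] n

  0<x*y : ∀ {x y} → 0# < x → 0# < y → 0# < x * y
  0<x*y {x} {y} (0≤x , 0≉x) 0<y@(0≤y , 0≉y) = *-nonNeg 0≤x 0≤y , λ 0≈xy → 0≉x (begin-equality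
    0#              ≈⟨ zeroˡ (y ⁻¹) ⟨
    0# * y ⁻¹       ≈⟨ *-congʳ 0≈xy ⟩
    x * y * y ⁻¹    ≈⟨ *-assoc x y (y ⁻¹) ⟩
    x * (y * y ⁻¹)  ≈⟨ *-congˡ (⁻¹-inverseʳ (0≉y ∘ sym)) ⟩
    x * 1#          ≈⟨ *-identityʳ x ⟩
    x               ∎)

  -- The tester's guarantees assume a confidence parameter below 1, so this is checked for δ/n
  -- before the tester is called with it.
  x<1⇒x/n<1 : ∀ n {x} → 0# < x → x < 1# → x / fromℕ (suc n) < 1#
  x<1⇒x/n<1 n {x} 0<x x<1 = begin-strict
    y                    ≤⟨ x≤x+y (*-nonNeg (proj₁ (0<x/y 0<x (0<fromℕ[1+n] n))) (0≤fromℕ n)) ⟩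
    y + y * fromℕ n      ≈⟨ +-congʳ (*-identityʳ y) ⟨
    y * 1# + y * fromℕ n ≈⟨ distribˡ y 1# (fromℕ n) ⟨
    y * fromℕ (suc n)    ≈⟨ x/y*y≈x x (0<fromℕ[1+n] n) ⟩
    x                    <⟨ x<1 ⟩
    1#                   ∎
    where y = x / fromℕ (suc n)

  x/2+x/2≈x : ∀ x → x / fromℕ 2 + x / fromℕ 2 ≈ x
  x/2+x/2≈x x = begin-equality
    x / fromℕ 2 + x / fromℕ 2              ≈⟨ +-cong (*-identityʳ _) (trans (*-congˡ (+-identityʳ 1#)) (*-identityʳ _)) ⟨
    x / fromℕ 2 * 1# + x / fromℕ 2 * fromℕ 1  ≈⟨ distribˡ _ 1# (fromℕ 1) ⟨
    x / fromℕ 2 * fromℕ 2                  ≈⟨ x/y*y≈x x (0<fromℕ[1+n] 1) ⟩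
    x                                      ∎

  -- Together with `-x≤∣x∣` and `∣x∣≤y` this makes `∣ x ∣` the least upper bound of `x` and `- x`;
  -- later facts about absolute values rest on these three alone.
  x≤∣x∣ : ∀ x → x ≤ ∣ x ∣
  x≤∣x∣ x with 0# ≤? x
  ... | yes _   = ≤-refl
  ... | no 0≰x with total x 0#
  ...   | inj₁ x≤0 = begin
    x     ≤⟨ x≤0 ⟩
    0#    ≈⟨ -0#≈0# ⟨
    - 0#  ≤⟨ neg-antimono-≤ x≤0 ⟩
    - x   ∎
  ...   | inj₂ 0≤x = contradiction 0≤x 0≰x

  -x≤∣x∣ : ∀ x → - x ≤ ∣ x ∣
  -x≤∣x∣ x with 0# ≤? x
  ... | no _    = ≤-refl
  ... | yes 0≤x = begin
    - x   ≤⟨ neg-antimono-≤ 0≤x ⟩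
    - 0#  ≈⟨ -0#≈0# ⟩
    0#    ≤⟨ 0≤x ⟩
    x     ∎

  ∣x∣≤y : ∀ {x y} → x ≤ y → - x ≤ y → ∣ x ∣ ≤ y
  ∣x∣≤y {x} x≤y -x≤y with 0# ≤? x
  ... | yes _ = x≤y
  ... | no _  = -x≤y

  -- `∣_∣` branches on separate decisions for `x` and `y`, so compatibility with `≈` is not
  -- immediate; it follows from the least upper bound property.
  ∣x∣≤∣y∣ : ∀ {x y} → x ≈ y → ∣ x ∣ ≤ ∣ y ∣
  ∣x∣≤∣y∣ {x} {y} x≈y = ∣x∣≤y
    (≤-respˡ-≈ (sym x≈y) (x≤∣x∣ y))
    (≤-respˡ-≈ (-‿cong (sym x≈y)) (-x≤∣x∣ y))

  ∣x+y∣≤∣x∣+∣y∣ : ∀ x y → ∣ x + y ∣ ≤ ∣ x ∣ + ∣ y ∣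
  ∣x+y∣≤∣x∣+∣y∣ x y = ∣x∣≤y
    (+-mono-≤ (x≤∣x∣ x) (x≤∣x∣ y))
    (≤-respˡ-≈ (-‿+-comm x y) (+-mono-≤ (-x≤∣x∣ x) (-x≤∣x∣ y)))

  ∣-x∣≤∣x∣ : ∀ x → ∣ - x ∣ ≤ ∣ x ∣
  ∣-x∣≤∣x∣ x = ∣x∣≤y (-x≤∣x∣ x) (≤-respˡ-≈ (sym (-‿involutive x)) (x≤∣x∣ x))

  sum-mono-≤ : ∀ {n} {v w : Vector Carrier n} → (∀ i → v i ≤ w i) → sum v ≤ sum w
  sum-mono-≤ {zero}  v≤w = ≤-refl
  sum-mono-≤ {suc n} v≤w = +-mono-≤ (v≤w zero) (sum-mono-≤ (v≤w ∘ suc))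

  sum-nonNeg : ∀ {n} {v : Vector Carrier n} → (∀ i → 0# ≤ v i) → 0# ≤ sum v
  sum-nonNeg {zero}  0≤v = ≤-refl
  sum-nonNeg {suc n} 0≤v = ≤-trans (0≤v zero) (x≤x+y (sum-nonNeg (0≤v ∘ suc)))

-- Distributions, powers of the transition matrix and ℓ₁ distance.

module ChainProperties {c ℓ₁ ℓ₂} (F : OrderedField c ℓ₁ ℓ₂) where
  open OrderedField F hiding (zero)
  open Chains F
  open OrderedFieldProperties F
  open Algebra.Properties.Ring ring
  open import Algebra.Properties.Semiring.Sum semiring
    using (sum-cong-≋; ∑-distrib-+; ∑-comm; *-distribˡ-sum; *-distribʳ-sum; sum-replicate-zero)
  open NonStrictToStrict _≈_ _≤_ using (≰⇒>)
  open Relation.Binary.Reasoning.PartialOrder poset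

  sum-unit : ∀ {n} (u : Fin n) (x : Vector Carrier n) → sum (λ i → unit u i * x i) ≈ x u
  sum-unit {suc n} zero x = begin-equality
    1# * x zero + sum (λ i → 0# * x (suc i))
      ≈⟨ +-cong (*-identityˡ _) (trans (sum-cong-≋ (λ i → zeroˡ (x (suc i)))) (sum-replicate-zero n)) ⟩
    x zero + 0#
      ≈⟨ +-identityʳ _ ⟩
    x zero
      ∎
  sum-unit (suc u) x = begin-equality
    0# * x zero + sum (λ i → unit u i * x (suc i))  ≈⟨ +-cong (zeroˡ _) (sum-unit u (x ∘ suc)) ⟩
    0# + x (suc u)                                  ≈⟨ +-identityˡ _ ⟩
    x (suc u)                                       ∎

  -- Associativity of row vector, matrix and column vector, by exchanging the sums. With `x`
  -- constantly 1 it shows that total mass is preserved; with `x` the acceptance probabilities of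
  -- the continuations it is the law of one more step of the walk.
  sum-⊡ : ∀ {n} (p : Vector Carrier n) (M : Matrix n) (x : Vector Carrier n) →
          sum (λ j → (p ⊡ M) j * x j) ≈ sum (λ i → p i * sum (λ j → M i j * x j))
  sum-⊡ p M x = begin-equality
    sum (λ j → sum (λ i → p i * M i j) * x j)    ≈⟨ sum-cong-≋ (λ j → *-distribʳ-sum (x j) (λ i → p i * M i j)) ⟩
    sum (λ j → sum (λ i → p i * M i j * x j))    ≈⟨ ∑-comm (λ j i → p i * M i j * x j) ⟩
    sum (λ i → sum (λ j → p i * M i j * x j))    ≈⟨ sum-cong-≋ (λ i → sum-cong-≋ (λ j → *-assoc (p i) (M i j) (x j))) ⟩
    sum (λ i → sum (λ j → p i * (M i j * x j)))  ≈⟨ sum-cong-≋ (λ i → *-distribˡ-sum (p i) (λ j → M i j * x j)) ⟨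
    sum (λ i → p i * sum (λ j → M i j * x j))    ∎

  sum-*1 : ∀ {n} (p : Vector Carrier n) → sum (λ i → p i * 1#) ≈ sum p
  sum-*1 p = sum-cong-≋ (λ i → *-identityʳ (p i))

  unit-isDistribution : ∀ {n} (u : Fin n) → IsDistribution (unit u)
  unit-isDistribution u = 0≤unit , trans (sym (sum-*1 (unit u))) (sum-unit u (λ _ → 1#))
    where
    0≤unit : ∀ i → 0# ≤ unit u i
    0≤unit i with does (u Fin.≟ i)
    ... | true  = 0≤1
    ... | false = ≤-refl

  ⊡-isDistribution : ∀ {n} {p : Vector Carrier n} {M : Matrix n} →
                     IsDistribution p → IsMarkovChain M → IsDistribution (p ⊡ M)
  ⊡-isDistribution {p = p} {M} (0≤p , ∑p≈1) isMarkov =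
    (λ j → sum-nonNeg (λ i → *-nonNeg (0≤p i) (proj₁ (isMarkov i) j))) , (begin-equality
    sum (p ⊡ M)                                 ≈⟨ sum-*1 (p ⊡ M) ⟨
    sum (λ j → (p ⊡ M) j * 1#)                  ≈⟨ sum-⊡ p M (λ _ → 1#) ⟩
    sum (λ i → p i * sum (λ j → M i j * 1#))    ≈⟨ sum-cong-≋ (λ i → *-congˡ (trans (sum-*1 (M i)) (proj₂ (isMarkov i)))) ⟩
    sum (λ i → p i * 1#)                        ≈⟨ sum-*1 p ⟩
    sum p                                       ≈⟨ ∑p≈1 ⟩
    1#                                          ∎)

  ^-isMarkovChain : ∀ {n} {M : Matrix n} → IsMarkovChain M → ∀ t → IsMarkovChain (M ^ t)
  ^-isMarkovChain isMarkov zero    u = unit-isDistribution u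
  ^-isMarkovChain isMarkov (suc t) u = ⊡-isDistribution (^-isMarkovChain isMarkov t u) isMarkov

  distance-congˡ : ∀ {n} {v w : Vector Carrier n} (s : Vector Carrier n) →
                   (∀ i → v i ≈ w i) → ‖ v ⊖ s ‖₁ ≤ ‖ w ⊖ s ‖₁
  distance-congˡ s v≈w = sum-mono-≤ (λ i → ∣x∣≤∣y∣ (+-congʳ (v≈w i)))

  distance-triangle : ∀ {n} (v w s : Vector Carrier n) →
                      ‖ v ⊖ w ‖₁ ≤ ‖ v ⊖ s ‖₁ + ‖ w ⊖ s ‖₁
  distance-triangle v w s = begin
    sum (λ i → ∣ v i - w i ∣)                        ≤⟨ sum-mono-≤ triangle ⟩
    sum (λ i → ∣ v i - s i ∣ + ∣ w i - s i ∣)        ≈⟨ ∑-distrib-+ (λ i → ∣ v i - s i ∣) (λ i → ∣ w i - s i ∣) ⟩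
    ‖ v ⊖ s ‖₁ + ‖ w ⊖ s ‖₁                          ∎
    where
    triangle : ∀ i → ∣ v i - w i ∣ ≤ ∣ v i - s i ∣ + ∣ w i - s i ∣
    triangle i = begin
      ∣ v i - w i ∣                          ≤⟨ ∣x∣≤∣y∣ split ⟩
      ∣ (v i - s i) + - (w i - s i) ∣        ≤⟨ ∣x+y∣≤∣x∣+∣y∣ _ _ ⟩
      ∣ v i - s i ∣ + ∣ - (w i - s i) ∣      ≤⟨ +-mono-≤ ≤-refl (∣-x∣≤∣x∣ _) ⟩
      ∣ v i - s i ∣ + ∣ w i - s i ∣          ∎
      where
      split : v i - w i ≈ (v i - s i) + - (w i - s i)
      split = begin-equality
        v i - w i                        ≈⟨ +-congʳ (//-rightDividesˡ (s i) (v i)) ⟨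
        v i - s i + s i - w i            ≈⟨ +-assoc _ _ _ ⟩
        (v i - s i) + (s i - w i)        ≈⟨ +-congˡ (⁻¹-anti-homo‿- (w i) (s i)) ⟨
        (v i - s i) + - (w i - s i)      ∎

  distance-refl : ∀ {n} (v : Vector Carrier n) → ‖ v ⊖ v ‖₁ ≤ 0#
  distance-refl {n} v = begin
    sum (λ i → ∣ v i - v i ∣)  ≤⟨ sum-mono-≤ (λ i → ∣x∣≤y (≤-reflexive (-‿inverseʳ (v i))) (neg≤0 i)) ⟩
    sum (λ (_ : Fin n) → 0#)   ≈⟨ sum-replicate-zero n ⟩
    0#                         ∎
    where
    neg≤0 : ∀ i → - (v i - v i) ≤ 0#
    neg≤0 i = ≤-reflexive (trans (-‿cong (-‿inverseʳ (v i))) -0#≈0#)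

  mixing⇒close : ∀ {n} {M : Matrix n} {ε t} → Mixing M (ε / fromℕ 2) t →
                 ∀ u v → ‖ (M ^ t) u ⊖ (M ^ t) v ‖₁ ≤ ε
  mixing⇒close {M = M} {ε} {t} (s , _ , close) u v = begin
    ‖ (M ^ t) u ⊖ (M ^ t) v ‖₁                     ≤⟨ distance-triangle _ _ s ⟩
    ‖ (M ^ t) u ⊖ s ‖₁ + ‖ (M ^ t) v ⊖ s ‖₁        ≤⟨ +-mono-≤ (row u) (row v) ⟩
    ε / fromℕ 2 + ε / fromℕ 2                      ≈⟨ x/2+x/2≈x ε ⟩
    ε                                              ∎
    where
    row : ∀ u → ‖ (M ^ t) u ⊖ s ‖₁ ≤ ε / fromℕ 2
    row u = ≤-trans (distance-congˡ s (λ i → sym (sum-unit u (λ j → (M ^ t) j i)))) (close u)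

  -- The state is found constructively: `≤` is decidable and there are finitely many states, so a
  -- failing universal statement has a counterexample.
  ¬mixing⇒far : ∀ {n} {M : Matrix n} {ε t} → IsMarkovChain M → ¬ Mixing M ε t →
                ∀ v → ∃[ u ] ε < ‖ (M ^ t) u ⊖ (M ^ t) v ‖₁
  ¬mixing⇒far {n} {M} {ε} {t} isMarkov ¬mixing v =
    let u , u≰ε = Fin.¬∀⟶∃¬ n (λ u → ‖ (M ^ t) u ⊖ (M ^ t) v ‖₁ ≤ ε) (λ u → _ ≤? ε)
                    (λ close → ¬mixing ((M ^ t) v , ^-isMarkovChain isMarkov t v , λ u →
                      ≤-trans (distance-congˡ _ (λ i → sum-unit u (λ j → (M ^ t) j i))) (close u)))
    in u , ≰⇒> sym ≤-reflexive total u≰ε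

-- Step bounds and acceptance probabilities of runs.

module Execution {c ℓ₁ ℓ₂} (F : OrderedField c ℓ₁ ℓ₂) where
  open OrderedField F hiding (zero)
  open Machine F
  open import Algebra.Properties.Semiring.Sum semiring using (sum-cong-≋)

  mutual
    decides-mono : ∀ {j k} C → j ℕ.≤ k → DecidesWithin j C → DecidesWithin k C
    decides-mono C (s≤s j≤k) = decidesAfter-mono (step C) j≤k

    decidesAfter-mono : ∀ {j k} s → j ℕ.≤ k → DecidesAfter j s → DecidesAfter k s
    decidesAfter-mono (halt (bool _)) j≤k d = tt
    decidesAfter-mono (goto C)        j≤k d = decides-mono C j≤k d
    decidesAfter-mono (choose p C)    j≤k d = λ i → decides-mono (C i) j≤k (d i)

  mutual
    Pr-stable : ∀ {j k} C b → j ℕ.≤ k → DecidesWithin j C → Pr k C b ≈ Pr j C b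
    Pr-stable C b (s≤s j≤k) = PrAfter-stable (step C) b j≤k

    PrAfter-stable : ∀ {j k} s b → j ℕ.≤ k → DecidesAfter j s → PrAfter k s b ≈ PrAfter j s b
    PrAfter-stable (halt (bool _)) b j≤k d = refl
    PrAfter-stable (goto C)        b j≤k d = Pr-stable C b j≤k d
    PrAfter-stable (choose p C)    b j≤k d =
      sum-cong-≋ (λ i → *-congˡ (Pr-stable (C i) b j≤k (d i)))

  -- Bound and probability travel together because `Pr k C` is certain to be final only once `k`
  -- steps suffice to decide.
  Runs : ℕ → Config → Carrier → Set ℓ₁
  Runs k C x = DecidesWithin k C × Pr k C true ≈ x

  runs-mono : ∀ {j k} C {x} → j ℕ.≤ k → Runs j C x → Runs k C x
  runs-mono C j≤k (d , eq) = decides-mono C j≤k d , trans (Pr-stable C true j≤k d) eq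

  runs-cong : ∀ k C {x y} → x ≈ y → Runs k C x → Runs k C y
  runs-cong _ _ x≈y (d , eq) = d , trans eq x≈y

  -- Sampling in continuation form: `C` counts as drawing from `p` if it averages the acceptance
  -- probabilities of any continuations with a common step bound. Consecutive draws then compose by
  -- nesting.
  Samples : ∀ {n} → ℕ → Config → Vector Carrier n → (Fin n → Config) → Set (c ⊔ ℓ₁)
  Samples {n} cost C p D = ∀ {k} {x : Vector Carrier n} →
    (∀ i → Runs k (D i) (x i)) → Runs (cost ℕ.+ k) C (sum (λ i → p i * x i))

  samples-step : ∀ {n} C {p : Vector Carrier n} {D} → step C ≡ choose p D → Samples 1 C p D
  samples-step C eq runs rewrite eq =
    (λ i → proj₁ (runs i)) , sum-cong-≋ (λ i → *-congˡ (proj₂ (runs i)))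

  runs-goto : ∀ k C D {x} → step C ≡ goto D → Runs k D x → Runs (suc k) C x
  runs-goto k C D eq runs rewrite eq = runs

  -- Like a primitive `sampler`, the value must cope with any argument and leave stack and memory as
  -- they were; only the number of steps may differ.
  Implements : ∀ {n} → ℕ → Value → Vector Carrier n → Set (c ⊔ ℓ₁)
  Implements cost f p = ∀ v K μ →
    Samples cost (return v (appʳ f ∷ K) μ) p (λ i → return (nat (toℕ i)) K μ)

-- Simulation of a tester's own run inside a larger run.

rename : ∀ {k m} → (Fin k → Fin m) → Program k → Program m
rename σ (var x)      = var (σ x)
rename σ (nat m)      = nat m
rename σ (bool b)     = bool b
rename σ (fun e)      = fun (rename (lift 2 σ) e)
rename σ (app d e)    = app (rename σ d) (rename σ e)
rename σ (op₁ o e)    = op₁ o (rename σ e)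
rename σ (op₂ o d e)  = op₂ o (rename σ d) (rename σ e)
rename σ (cond b d e) = cond (rename σ b) (rename σ d) (rename σ e)

-- A run is unaffected by renaming variables, replacing samplers by values that
-- implement them, putting frames under the stack and putting cells in front of
-- the memory: addresses are only ever shifted, read and written.
module Simulation {c ℓ₁ ℓ₂} (F : OrderedField c ℓ₁ ℓ₂)
  (cost : ℕ) (1≤cost : 1 ℕ.≤ cost) (K₀ : Machine.Stack F) (μ₀ : Machine.Memory F) where
  open OrderedField F hiding (zero)
  open Machine F
  open Chains F
  open Execution F
  open OrderedFieldProperties F
  open import Algebra.Properties.Semiring.Sum semiring
    using (sum-cong-≋; ∑-distrib-+; *-distribʳ-sum; sum-replicate)
  open Relation.Binary.Reasoning.PartialOrder poset

  infix 4 _∼_ _∼ᶠ_ _∼ˢ_ _∼ᶜ_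

  -- Closures are related up to renaming because those created by the embedded tester capture the
  -- larger environment of the test. The `sampler` case also records `IsDistribution p`, so that the
  -- relation guarantees that all draws in the run are from distributions.
  data _∼_ : Value → Value → Set (c ⊔ ℓ₁ ⊔ ℓ₂) where
    nat     : ∀ {m} → nat m ∼ nat m
    bool    : ∀ {b} → bool b ∼ bool b
    scalar  : ∀ {x} → scalar x ∼ scalar x
    pair    : ∀ {v w v′ w′} → v ∼ v′ → w ∼ w′ → pair v w ∼ pair v′ w′
    address : ∀ {a} → address a ∼ address (length μ₀ ℕ.+ a)
    closure : ∀ {k m} {e : Program (suc (suc k))} {ρ} {ρ′ : Env m} (σ : Fin k → Fin m) →
              (∀ x → lookup ρ x ∼ lookup ρ′ (σ x)) →
              closure e ρ ∼ closure (rename (lift 2 σ) e) ρ′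
    sampler : ∀ {n f} {p : Vector Carrier n} → IsDistribution p → Implements cost f p →
              sampler p ∼ f

  RelatedEnvs : ∀ {k m} → (Fin k → Fin m) → Env k → Env m → Set (c ⊔ ℓ₁ ⊔ ℓ₂)
  RelatedEnvs σ ρ ρ′ = ∀ x → lookup ρ x ∼ lookup ρ′ (σ x)

  data _∼ᶠ_ : Frame → Frame → Set (c ⊔ ℓ₁ ⊔ ℓ₂) where
    appˡ : ∀ {k m e} {ρ : Env k} {ρ′ : Env m} σ → RelatedEnvs σ ρ ρ′ →
           appˡ e ρ ∼ᶠ appˡ (rename σ e) ρ′
    appʳ : ∀ {f f′} → f ∼ f′ → appʳ f ∼ᶠ appʳ f′
    op₁  : ∀ {o} → op₁ o ∼ᶠ op₁ o
    op₂ˡ : ∀ {k m o e} {ρ : Env k} {ρ′ : Env m} σ → RelatedEnvs σ ρ ρ′ →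
           op₂ˡ o e ρ ∼ᶠ op₂ˡ o (rename σ e) ρ′
    op₂ʳ : ∀ {o v v′} → v ∼ v′ → op₂ʳ o v ∼ᶠ op₂ʳ o v′
    cond : ∀ {k m d e} {ρ : Env k} {ρ′ : Env m} σ → RelatedEnvs σ ρ ρ′ →
           cond d e ρ ∼ᶠ cond (rename σ d) (rename σ e) ρ′

  data _∼ˢ_ : Stack → Stack → Set (c ⊔ ℓ₁ ⊔ ℓ₂) where
    base : [] ∼ˢ K₀
    _∷_  : ∀ {φ φ′ K K′} → φ ∼ᶠ φ′ → K ∼ˢ K′ → φ ∷ K ∼ˢ φ′ ∷ K′

  data _∼ᶜ_ : Config → Config → Set (c ⊔ ℓ₁ ⊔ ℓ₂) where
    eval   : ∀ {k m} {e : Program k} {ρ} {ρ′ : Env m} {K K′ μ μ′} σ →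
             RelatedEnvs σ ρ ρ′ → K ∼ˢ K′ → Pointwiseᴸ _∼_ μ μ′ →
             eval e ρ K μ ∼ᶜ eval (rename σ e) ρ′ K′ (μ₀ ++ μ′)
    return : ∀ {v v′ K K′ μ μ′} → v ∼ v′ → K ∼ˢ K′ → Pointwiseᴸ _∼_ μ μ′ →
             return v K μ ∼ᶜ return v′ K′ (μ₀ ++ μ′)

  -- Configurations that get stuck are excluded by a DecidesAfter hypothesis.
  data StepSimulation : Step → Config → Set (c ⊔ ℓ₁ ⊔ ℓ₂) where
    halt   : ∀ b {μ′} → StepSimulation (halt (bool b)) (return (bool b) K₀ (μ₀ ++ μ′))
    goto   : ∀ {C C′ D′} → step D′ ≡ goto C′ → C ∼ᶜ C′ → StepSimulation (goto C) D′
    choose : ∀ {n} {p : Vector Carrier n} {C C′ D′} → IsDistribution p →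
             Samples cost D′ p C′ → (∀ i → C i ∼ᶜ C′ i) → StepSimulation (choose p C) D′

  closureEnv : ∀ {k m v v′ e} {ρ : Env k} {ρ′ : Env m} (σ : Fin k → Fin m) →
               v ∼ v′ → RelatedEnvs σ ρ ρ′ →
               RelatedEnvs (lift 2 σ) (v ∷ closure e ρ ∷ ρ) (v′ ∷ closure (rename (lift 2 σ) e) ρ′ ∷ ρ′)
  closureEnv σ v∼v′ ρ∼ρ′ zero          = v∼v′
  closureEnv σ v∼v′ ρ∼ρ′ (suc zero)    = closure σ ρ∼ρ′
  closureEnv σ v∼v′ ρ∼ρ′ (suc (suc x)) = ρ∼ρ′ x

  uniform-isDistribution : ∀ m → IsDistribution {suc m} (λ _ → 1# / fromℕ (suc m))
  uniform-isDistribution m =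
    (λ _ → proj₁ (0<x/y (0≤1 , 0≉1) (0<fromℕ[1+n] m))) , (begin-equality
    sum {suc m} (λ _ → 1/m)                ≈⟨ sum-cong-≋ {suc m} (λ _ → *-identityˡ 1/m) ⟨
    sum {suc m} (λ _ → 1# * 1/m)           ≈⟨ *-distribʳ-sum {suc m} 1/m (λ _ → 1#) ⟨
    sum {suc m} (λ _ → 1#) * 1/m           ≈⟨ *-congʳ (sum-replicate (suc m)) ⟩
    fromℕ (suc m) * 1/m                    ≈⟨ *-comm _ _ ⟩
    1/m * fromℕ (suc m)                    ≈⟨ x/y*y≈x 1# (0<fromℕ[1+n] m) ⟩
    1#                                     ∎)
    where 1/m = 1# / fromℕ (suc m)

  samples-choose : ∀ {n C} {p : Vector Carrier n} {D} → step C ≡ choose p D → Samples cost C p D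
  samples-choose {C = C} {D = D} eq {k} runs =
    runs-mono C (ℕ.+-monoˡ-≤ k 1≤cost) (samples-step C {D = D} eq runs)

  ∷ʳ⁺ : ∀ {μ μ′ v v′} → Pointwiseᴸ _∼_ μ μ′ → v ∼ v′ → Pointwiseᴸ _∼_ (μ ∷ʳ v) (μ′ ∷ʳ v′)
  ∷ʳ⁺ μ∼μ′ v∼v′ = List.++⁺ μ∼μ′ (v∼v′ ∷ [])

  readAt⁺ : ∀ {μ μ′} → Pointwiseᴸ _∼_ μ μ′ → ∀ a → Pointwiseᴹ _∼_ (readAt μ a) (readAt μ′ a)
  readAt⁺ []             a       = nothing
  readAt⁺ (v∼v′ ∷ _)     zero    = just v∼v′
  readAt⁺ (_    ∷ μ∼μ′)  (suc a) = readAt⁺ μ∼μ′ a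

  writeAt⁺ : ∀ {μ μ′ v v′} → Pointwiseᴸ _∼_ μ μ′ → v ∼ v′ → ∀ a →
             Pointwiseᴹ (Pointwiseᴸ _∼_) (writeAt μ a v) (writeAt μ′ a v′)
  writeAt⁺ []            v∼v′ a       = nothing
  writeAt⁺ (_   ∷ μ∼μ′)  v∼v′ zero    = just (v∼v′ ∷ μ∼μ′)
  writeAt⁺ {μ = _ ∷ μ} {_ ∷ μ′} {v} {v′} (w∼w′ ∷ μ∼μ′) v∼v′ (suc a)
    with writeAt μ a v | writeAt μ′ a v′ | writeAt⁺ μ∼μ′ v∼v′ a
  ... | _ | _ | nothing = nothing
  ... | _ | _ | just ∼  = just (w∼w′ ∷ ∼)

  readAt-++ : ∀ (μ ν : Memory) a → readAt (μ ++ ν) (length μ ℕ.+ a) ≡ readAt ν a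
  readAt-++ []      ν a = ≡.refl
  readAt-++ (_ ∷ μ) ν a = readAt-++ μ ν a

  writeAt-++ : ∀ (μ ν : Memory) a v →
               writeAt (μ ++ ν) (length μ ℕ.+ a) v ≡ Maybe.map (μ ++_) (writeAt ν a v)
  writeAt-++ []      ν a v with writeAt ν a v
  ... | just _  = ≡.refl
  ... | nothing = ≡.refl
  writeAt-++ (w ∷ μ) ν a v rewrite writeAt-++ μ ν a v with writeAt ν a v
  ... | just _  = ≡.refl
  ... | nothing = ≡.refl

  apply-simulation : ∀ {k f f′ v v′ K K′ μ μ′} → f ∼ f′ → v ∼ v′ → K ∼ˢ K′ → Pointwiseᴸ _∼_ μ μ′ →
                     DecidesAfter k (apply f v K μ) →
                     StepSimulation (apply f v K μ) (return v′ (appʳ f′ ∷ K′) (μ₀ ++ μ′))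
  apply-simulation (closure σ ρ∼ρ′) v∼v′ K∼K′ μ∼μ′ _ =
    goto ≡.refl (eval (lift 2 σ) (closureEnv σ v∼v′ ρ∼ρ′) K∼K′ μ∼μ′)
  apply-simulation (sampler isDist impl) v∼v′ K∼K′ μ∼μ′ _ =
    choose isDist (impl _ _ _) (λ _ → return nat K∼K′ μ∼μ′)

  apply₁-simulation : ∀ {k} o {v v′ K K′ μ μ′} → v ∼ v′ → K ∼ˢ K′ → Pointwiseᴸ _∼_ μ μ′ →
                      DecidesAfter k (apply₁ o v K μ) →
                      StepSimulation (apply₁ o v K μ) (return v′ (op₁ o ∷ K′) (μ₀ ++ μ′))
  apply₁-simulation fst (pair v w) K∼K′ μ∼μ′ _ = goto ≡.refl (return v K∼K′ μ∼μ′)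
  apply₁-simulation snd (pair v w) K∼K′ μ∼μ′ _ = goto ≡.refl (return w K∼K′ μ∼μ′)
  apply₁-simulation toScalar nat K∼K′ μ∼μ′ _ = goto ≡.refl (return scalar K∼K′ μ∼μ′)
  apply₁-simulation random (nat {suc m}) K∼K′ μ∼μ′ _ =
    choose (uniform-isDistribution m) (samples-choose ≡.refl) (λ _ → return nat K∼K′ μ∼μ′)
  apply₁-simulation new {v} {v′} {K} {K′} {μ} {μ′} v∼v′ K∼K′ μ∼μ′ _ =
    -- A fresh address is the length of the memory, so the cells of `μ₀` shift it by exactly
    -- `length μ₀`.
    goto (≡.cong₂ (λ a ν → goto (return (address a) K′ ν)) length-new (List.++-assoc μ₀ μ′ (v′ ∷ [])))
         (return address K∼K′ (∷ʳ⁺ μ∼μ′ v∼v′))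
    where
    length-new : length (μ₀ ++ μ′) ≡ length μ₀ ℕ.+ length μ
    length-new = ≡.trans (List.length-++ μ₀) (≡.cong (length μ₀ ℕ.+_) (≡.sym (List.Pointwise-length μ∼μ′)))
  apply₁-simulation read {K′ = K′} {μ} {μ′} (address {a}) K∼K′ μ∼μ′ d
    with readAt μ a | readAt μ′ a in eq | readAt⁺ μ∼μ′ a
  ... | _ | _ | just v∼v′ =
    goto (≡.cong (Maybe.maybe′ (λ v → goto (return v K′ (μ₀ ++ μ′))) stuck) (≡.trans (readAt-++ μ₀ μ′ a) eq))
         (return v∼v′ K∼K′ μ∼μ′)

  apply₂-simulation : ∀ {k} o {v v′ w w′ K K′ μ μ′} →
                      v ∼ v′ → w ∼ w′ → K ∼ˢ K′ → Pointwiseᴸ _∼_ μ μ′ →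
                      DecidesAfter k (apply₂ o v w K μ) →
                      StepSimulation (apply₂ o v w K μ) (return w′ (op₂ʳ o v′ ∷ K′) (μ₀ ++ μ′))
  apply₂-simulation pair      v      w      K μ _ = goto ≡.refl (return (pair v w) K μ)
  apply₂-simulation addℕ      nat    nat    K μ _ = goto ≡.refl (return nat K μ)
  apply₂-simulation monusℕ    nat    nat    K μ _ = goto ≡.refl (return nat K μ)
  apply₂-simulation mulℕ      nat    nat    K μ _ = goto ≡.refl (return nat K μ)
  apply₂-simulation leqℕ      nat    nat    K μ _ = goto ≡.refl (return bool K μ)
  apply₂-simulation addScalar scalar scalar K μ _ = goto ≡.refl (return scalar K μ)
  apply₂-simulation subScalar scalar scalar K μ _ = goto ≡.refl (return scalar K μ)
  apply₂-simulation mulScalar scalar scalar K μ _ = goto ≡.refl (return scalar K μ)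
  apply₂-simulation divScalar scalar scalar K μ _ = goto ≡.refl (return scalar K μ)
  apply₂-simulation leqScalar scalar scalar K μ _ = goto ≡.refl (return bool K μ)
  apply₂-simulation shift {K′ = K′} {μ′ = μ′} (address {a}) (nat {i}) K μ _ =
    goto (≡.cong (λ a → goto (return (address a) K′ (μ₀ ++ μ′))) (ℕ.+-assoc (length μ₀) a i)) (return address K μ)
  apply₂-simulation write {w = w} {w′} {K′ = K′} {μ} {μ′} (address {a}) w∼w′ K∼K′ μ∼μ′ d
    with writeAt μ a w | writeAt μ′ a w′ in eq | writeAt⁺ μ∼μ′ w∼w′ a
  ... | _ | _ | just ν∼ν′ =
    goto (≡.cong (Maybe.maybe′ (λ ν → goto (return w′ K′ ν)) stuck)
           (≡.trans (writeAt-++ μ₀ μ′ a w′) (≡.cong (Maybe.map (μ₀ ++_)) eq)))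
         (return w∼w′ K∼K′ ν∼ν′)

  step-simulation : ∀ {k C C′} → C ∼ᶜ C′ → DecidesAfter k (step C) → StepSimulation (step C) C′
  step-simulation (eval {e = var x}      σ ρ K μ) _ = goto ≡.refl (return (ρ x) K μ)
  step-simulation (eval {e = nat m}      σ ρ K μ) _ = goto ≡.refl (return nat K μ)
  step-simulation (eval {e = bool b}     σ ρ K μ) _ = goto ≡.refl (return bool K μ)
  step-simulation (eval {e = fun e}      σ ρ K μ) _ = goto ≡.refl (return (closure σ ρ) K μ)
  step-simulation (eval {e = app d e}    σ ρ K μ) _ = goto ≡.refl (eval σ ρ (appˡ σ ρ ∷ K) μ)
  step-simulation (eval {e = op₁ o e}    σ ρ K μ) _ = goto ≡.refl (eval σ ρ (op₁ ∷ K) μ)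
  step-simulation (eval {e = op₂ o d e}  σ ρ K μ) _ = goto ≡.refl (eval σ ρ (op₂ˡ σ ρ ∷ K) μ)
  step-simulation (eval {e = cond b d e} σ ρ K μ) _ = goto ≡.refl (eval σ ρ (cond σ ρ ∷ K) μ)
  step-simulation (return (bool {b}) base μ) _ = halt b
  step-simulation (return v (appˡ σ ρ ∷ K) μ) _ = goto ≡.refl (eval σ ρ (appʳ v ∷ K) μ)
  step-simulation (return v (appʳ f ∷ K)   μ) d = apply-simulation f v K μ d
  step-simulation (return v (op₁ {o} ∷ K)  μ) d = apply₁-simulation o v K μ d
  step-simulation (return v (op₂ˡ σ ρ ∷ K) μ) _ = goto ≡.refl (eval σ ρ (op₂ʳ v ∷ K) μ)
  step-simulation (return v (op₂ʳ {o} w ∷ K) μ) d = apply₂-simulation o w v K μ d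
  step-simulation (return (bool {true})  (cond σ ρ ∷ K) μ) _ = goto ≡.refl (eval σ ρ K μ)
  step-simulation (return (bool {false}) (cond σ ρ ∷ K) μ) _ = goto ≡.refl (eval σ ρ K μ)

  mutual
    -- Here and in `Pr-total` the relation acts as an invariant of the left run: every draw it meets
    -- is from a distribution, which an arbitrary configuration does not ensure.
    Pr-nonNeg : ∀ {k C C′} b → C ∼ᶜ C′ → DecidesWithin k C → 0# ≤ Pr k C b
    Pr-nonNeg {suc k} b C∼C′ d = PrAfter-nonNeg {k} b (step-simulation {k} C∼C′ d) d

    PrAfter-nonNeg : ∀ {k s C′} b → StepSimulation s C′ → DecidesAfter k s → 0# ≤ PrAfter k s b
    PrAfter-nonNeg true  (halt true)  d = 0≤1
    PrAfter-nonNeg false (halt true)  d = ≤-refl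
    PrAfter-nonNeg true  (halt false) d = ≤-refl
    PrAfter-nonNeg false (halt false) d = 0≤1
    PrAfter-nonNeg {k} b (goto _ C∼C′) d = Pr-nonNeg {k} b C∼C′ d
    PrAfter-nonNeg {k} b (choose (0≤p , _) _ C∼C′) d =
      sum-nonNeg (λ i → *-nonNeg (0≤p i) (Pr-nonNeg {k} b (C∼C′ i) (d i)))

  mutual
    Pr-total : ∀ {k C C′} → C ∼ᶜ C′ → DecidesWithin k C → Pr k C true + Pr k C false ≈ 1#
    Pr-total {suc k} C∼C′ d = PrAfter-total {k} (step-simulation {k} C∼C′ d) d

    PrAfter-total : ∀ {k s C′} → StepSimulation s C′ → DecidesAfter k s →
                    PrAfter k s true + PrAfter k s false ≈ 1#
    PrAfter-total (halt true)  d = +-identityʳ 1#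
    PrAfter-total (halt false) d = +-identityˡ 1#
    PrAfter-total {k} (goto _ C∼C′) d = Pr-total {k} C∼C′ d
    PrAfter-total {k} (choose {p = p} {C} (_ , ∑p≈1) _ C∼C′) d = begin-equality
      sum (λ i → p i * Pr k (C i) true) + sum (λ i → p i * Pr k (C i) false)
        ≈⟨ ∑-distrib-+ (λ i → p i * Pr k (C i) true) (λ i → p i * Pr k (C i) false) ⟨
      sum (λ i → p i * Pr k (C i) true + p i * Pr k (C i) false)
        ≈⟨ sum-cong-≋ (λ i → trans (sym (distribˡ (p i) _ _)) (trans (*-congˡ (Pr-total {k} (C∼C′ i) (d i))) (*-identityʳ (p i)))) ⟩
      sum p
        ≈⟨ ∑p≈1 ⟩
      1#
        ∎

  module _ {k₀} {x : Carrier}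
    (accept : ∀ μ → Runs k₀ (return (bool true) K₀ (μ₀ ++ μ)) x)
    (reject : ∀ μ → Runs k₀ (return (bool false) K₀ (μ₀ ++ μ)) 0#) where

    k₀≤ : ∀ k → k₀ ℕ.≤ cost ℕ.+ (k ℕ.* cost ℕ.+ k₀)
    k₀≤ k = ℕ.≤-trans (ℕ.m≤n+m k₀ (k ℕ.* cost)) (ℕ.m≤n+m _ cost)

    mutual
      -- `accept` and `reject` describe the code waiting in `K₀`, for any memory that the tester may
      -- leave. Acceptance is linear in the outcome of a draw, so the factor `x` moves out of each
      -- sum; a step simulated cheaply, or an early halt, is padded up to the bound.
      simulation : ∀ {k C C′} → C ∼ᶜ C′ → DecidesWithin k C →
                   Runs (k ℕ.* cost ℕ.+ k₀) C′ (Pr k C true * x)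
      simulation {suc k} {C} {C′} C∼C′ d =
        ≡.subst (λ j → Runs j C′ (Pr (suc k) C true * x)) (≡.sym (ℕ.+-assoc cost (k ℕ.* cost) k₀))
          (simulationAfter {k} (step-simulation {k} C∼C′ d) d)

      simulationAfter : ∀ {k s C′} → StepSimulation s C′ → DecidesAfter k s →
                        Runs (cost ℕ.+ (k ℕ.* cost ℕ.+ k₀)) C′ (PrAfter k s true * x)
      simulationAfter {k} {C′ = C′} (halt true) d =
        runs-mono C′ (k₀≤ k) (runs-cong k₀ C′ (sym (*-identityˡ x)) (accept _))
      simulationAfter {k} {C′ = C′} (halt false) d =
        runs-mono C′ (k₀≤ k) (runs-cong k₀ C′ (sym (zeroˡ x)) (reject _))
      simulationAfter {k} {C′ = C′} (goto {C′ = D} eq C∼D) d =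
        runs-mono C′ (ℕ.+-monoˡ-≤ (k ℕ.* cost ℕ.+ k₀) 1≤cost) (runs-goto (k ℕ.* cost ℕ.+ k₀) C′ D eq (simulation {k} C∼D d))
      simulationAfter {k} {C′ = C′} (choose {p = p} {C} _ samples C∼D) d =
        runs-cong (cost ℕ.+ (k ℕ.* cost ℕ.+ k₀)) C′ linear
          (samples {k ℕ.* cost ℕ.+ k₀} {λ i → Pr k (C i) true * x} (λ i → simulation {k} (C∼D i) (d i)))
        where
        linear : sum (λ i → p i * (Pr k (C i) true * x)) ≈ sum (λ i → p i * Pr k (C i) true) * x
        linear = begin-equality
          sum (λ i → p i * (Pr k (C i) true * x))  ≈⟨ sum-cong-≋ (λ i → *-assoc (p i) _ x) ⟨
          sum (λ i → p i * Pr k (C i) true * x)    ≈⟨ *-distribʳ-sum x (λ i → p i * Pr k (C i) true) ⟨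
          sum (λ i → p i * Pr k (C i) true) * x    ∎

-- The test as a program.

module TestProgram where
  -- The context is the counter, the walk itself, the argument given to the sampler, the endpoint
  -- function and the seven entries of the loop, so `var (suc 9F)` is next_node. It is applied to
  -- the result of the shorter walk, as `M ^ suc t` multiplies by `M` on the right.
  walk : Program 11 → Program 11
  walk source =
    cond (op₂ leqℕ (var 0F) (nat 0))
      source
      (app (var (suc 9F)) (app (var 1F) (op₂ monusℕ (var 0F) (nat 1))))

  endpointBody : Program 11 → Program 9
  endpointBody source = app (fun (walk source)) (var 5F)

  -- The context of the tester adds to that of the loop two entries for each of
  -- δ / n and the two walks: the value and the function binding it.
  testerVar : Fin 5 → Fin 13
  testerVar 0F = 8F
  testerVar 1F = suc 9F
  testerVar 2F = 4F
  testerVar 3F = 2F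
  testerVar 4F = 0F

  -- The loop has the context u, the loop itself, n, t, ε, δ, next_node.
  compare : Program 5 → Program 7
  compare tester =
    app (app (app (fun (fun (fun (rename testerVar tester))))
                  (op₂ divScalar (var 5F) (op₁ toScalar (var 2F))))
             (fun (endpointBody (var 4F))))
        (fun (endpointBody (nat 0)))

  loopBody : Program 5 → Program 7
  loopBody tester =
    cond (op₂ leqℕ (var 0F) (nat 0))
      (bool true)
      (cond (compare tester)
        (app (var 1F) (op₂ monusℕ (var 0F) (nat 1)))
        (bool false))

  mixingTest : Program 5 → Program 5
  mixingTest tester = app (fun (loopBody tester)) (op₂ monusℕ (var 0F) (nat 1))

-- Running time and acceptance probability of the test.

module TestExecution {c ℓ₁ ℓ₂} (F : OrderedField c ℓ₁ ℓ₂) where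
  open OrderedField F hiding (zero)
  open Testing F
  open TestProgram
  open Execution F
  open OrderedFieldProperties F
  open ChainProperties F
  open NonStrictToStrict _≈_ _≤_ using (<⇒≱)
  open Relation.Binary.Reasoning.PartialOrder poset

  module Correctness
    (f : Carrier → Carrier) (T : ℕ → Carrier → Carrier → ℕ) (tester : Program 5)
    (isTester : IsL1Tester f T tester)
    {m} (M : Matrix (suc m)) (isMarkov : IsMarkovChain M) (t : ℕ) (ε δ : Carrier)
    (0<ε : 0# < ε) (0<d : 0# < δ / fromℕ (suc m)) (d<1 : δ / fromℕ (suc m) < 1#)
    where
    open IsL1Tester isTester

    n : ℕ
    n = suc m

    d : Carrier
    d = δ / fromℕ n

    inputs : Env 5
    inputs = nat n ∷ nat t ∷ scalar ε ∷ scalar δ ∷ next-node M ∷ []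

    loopEnv : ℕ → Env 7
    loopEnv u = nat u ∷ closure (loopBody tester) inputs ∷ inputs

    callEnv : ∀ {k} → Program (suc (suc k)) → Value → Env k → Env (suc (suc k))
    callEnv e v ρ = v ∷ closure e ρ ∷ ρ

    -- The numerals in the costs are the numbers of administrative machine steps;
    -- they are verified by the reduction of Runs.
    walkCost : ℕ → ℕ
    walkCost s = s ℕ.* 20 ℕ.+ 8

    step-next-node : ∀ (i : Fin n) K μ →
      step (return (nat (toℕ i)) (appʳ (next-node M) ∷ K) μ) ≡ choose (M i) (λ j → return (nat (toℕ j)) K μ)
    step-next-node i K μ with toℕ i ℕ.<? n
    ... | yes i<n rewrite Fin.fromℕ<-toℕ i i<n = ≡.refl
    ... | no  i≮n = contradiction (Fin.toℕ<n i) i≮n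

    walkEnv : Program 11 → ℕ → Value → Value → Env 11
    walkEnv source u v s = callEnv (walk source) s (callEnv (endpointBody source) v (loopEnv u))

    -- Treats both starting points at once: the loop counter `var 4F` and the constant `nat 0` each
    -- evaluate in a single step.
    EvaluatesTo : Program 11 → ℕ → Fin n → Set c
    EvaluatesTo source u a = ∀ v s K μ →
      step (eval source (walkEnv source u v s) K μ) ≡ goto (return (nat (toℕ a)) K μ)

    module _ {source : Program 11} {u : ℕ} {a : Fin n} (evaluates : EvaluatesTo source u a) where
      walk-samples : ∀ v s K μ →
        Samples (walkCost s) (eval (walk source) (walkEnv source u v (nat s)) K μ)
                ((M ^ s) a) (λ i → return (nat (toℕ i)) K μ)
      walk-samples v zero K μ {k} {x} runs =
        runs-goto k (eval source (walkEnv source u v (nat 0)) K μ) (return (nat (toℕ a)) K μ)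
          (evaluates v (nat 0) K μ)
          (runs-cong k (return (nat (toℕ a)) K μ) (sym (sum-unit a x)) (runs a))
      walk-samples v (suc s) K μ {k} {x} runs =
        -- 19 steps lead into the shorter walk; the twentieth is the oracle call, which the
        -- induction hypothesis sees as part of its continuation.
        runs-mono C (ℕ.≤-reflexive (≡.cong (19 ℕ.+_) (ℕ.+-suc (walkCost s) k)))
          (runs-cong (19 ℕ.+ (walkCost s ℕ.+ suc k)) C (sym (sum-⊡ ((M ^ s) a) M x))
            (walk-samples v s (appʳ (next-node M) ∷ K) μ {suc k}
              (λ i → samples-step (return (nat (toℕ i)) (appʳ (next-node M) ∷ K) μ)
                       (step-next-node i K μ) {k} {x} runs)))
        where
        C = eval (walk source) (walkEnv source u v (nat (suc s))) K μ

      endpoint-implements : Implements (6 ℕ.+ walkCost t) (closure (endpointBody source) (loopEnv u)) ((M ^ t) a)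
      endpoint-implements v K μ = walk-samples v t K μ

    cost : ℕ
    cost = 6 ℕ.+ walkCost t

    Tₙ : ℕ
    Tₙ = T n ε d

    row : Fin n → Vector Carrier n
    row = M ^ t

    row-isDistribution : ∀ u → IsDistribution (row u)
    row-isDistribution = ^-isMarkovChain isMarkov t

    comparison : Fin n → Config
    comparison u = runTester tester n ε d (row u) (row zero)

    accepting : Fin n → Carrier
    accepting u = Pr Tₙ (comparison u) true

    decided : ∀ u → DecidesWithin Tₙ (comparison u)
    decided u = decides 0<ε 0<d d<1 (row-isDistribution u) (row-isDistribution zero)

    module _ (K : Stack) (μ : Memory) where
      open Simulation F cost (s≤s z≤n) K μ

      comparisonEnv : ℕ → Env 13
      comparisonEnv u =
        callEnv (rename testerVar tester) (closure (endpointBody (nat 0)) (loopEnv u))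
          (callEnv (fun (rename testerVar tester)) (closure (endpointBody (var 4F)) (loopEnv u))
            (callEnv (fun (fun (rename testerVar tester))) (scalar d) (loopEnv u)))

      comparison-related : ∀ {u} v → toℕ v ≡ u →
        comparison v ∼ᶜ eval (rename testerVar tester) (comparisonEnv u) K (μ ++ [])
      comparison-related {u} v v≡u = eval testerVar related base []
        where
        related : RelatedEnvs testerVar
          (nat n ∷ scalar ε ∷ scalar d ∷ sampler (row v) ∷ sampler (row zero) ∷ []) (comparisonEnv u)
        related 0F = nat
        related 1F = scalar
        related 2F = scalar
        -- The walk starts from the numeral in the loop counter, which represents `v` by `v≡u`.
        related 3F = sampler (row-isDistribution v) (endpoint-implements {var 4F}
          (λ _ _ K μ → ≡.cong (λ u → goto (return (nat u) K μ)) (≡.sym v≡u)))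
        related 4F = sampler (row-isDistribution zero) (endpoint-implements {nat 0} (λ _ _ _ _ → ≡.refl))

      compare-runs : ∀ {u} (u<n : u ℕ.< n) {k₀ x} →
        (∀ μ′ → Runs k₀ (return (bool true) K (μ ++ μ′)) x) →
        (∀ μ′ → Runs k₀ (return (bool false) K (μ ++ μ′)) 0#) →
        Runs (21 ℕ.+ (Tₙ ℕ.* cost ℕ.+ k₀)) (eval (compare tester) (loopEnv u) K μ)
             (accepting (fromℕ< u<n) * x)
      compare-runs {u} u<n {k₀} {x} accept reject =
        -- The relation puts the tester's empty initial memory behind `μ`, giving `μ ++ []`, while
        -- the machine holds `μ`.
        ≡.subst (λ ν → Runs (Tₙ ℕ.* cost ℕ.+ k₀) (eval (rename testerVar tester) (comparisonEnv u) K ν)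
                            (accepting (fromℕ< u<n) * x))
          (List.++-identityʳ μ)
          (simulation accept reject {Tₙ} (comparison-related (fromℕ< u<n) (Fin.toℕ-fromℕ< u<n)) (decided (fromℕ< u<n)))

    module _ (u : Fin n) where
      open Simulation F cost (s≤s z≤n) [] []

      accepting-nonNeg : 0# ≤ accepting u
      accepting-nonNeg = Pr-nonNeg {Tₙ} true (comparison-related [] [] u ≡.refl) (decided u)

      rejecting-nonNeg : 0# ≤ Pr Tₙ (comparison u) false
      rejecting-nonNeg = Pr-nonNeg {Tₙ} false (comparison-related [] [] u ≡.refl) (decided u)

      accepting+rejecting : accepting u + Pr Tₙ (comparison u) false ≈ 1#
      accepting+rejecting = Pr-total {Tₙ} (comparison-related [] [] u ≡.refl) (decided u)

    -- A product because the loop continues only after an accepting comparison; state 0 contributes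
    -- no factor, its row being the reference.
    acceptance : ∀ u → u ℕ.< n → Carrier
    acceptance zero    u<n = 1#
    acceptance (suc u) u<n = accepting (fromℕ< u<n) * acceptance u (ℕ.<⇒≤ u<n)

    -- 39 is 8 steps to reach the comparison, 21 to enter the tester and 10 to return to the loop
    -- body.
    iterationCost : ℕ
    iterationCost = 39 ℕ.+ Tₙ ℕ.* cost

    loop-runs : ∀ u (u<n : u ℕ.< n) μ →
      Runs (u ℕ.* iterationCost ℕ.+ 9) (eval (loopBody tester) (loopEnv u) [] μ) (acceptance u u<n)
    loop-runs zero    u<n μ = tt , refl
    loop-runs (suc u) u<n μ =
      runs-mono C (ℕ.≤-reflexive eq) (compare-runs K μ u<n {10 ℕ.+ k}
        (λ μ′ → loop-runs u (ℕ.<⇒≤ u<n) (μ ++ μ′))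
        (λ μ′ → tt , refl))
      where
      K = cond (app (var 1F) (op₂ monusℕ (var 0F) (nat 1))) (bool false) (loopEnv (suc u)) ∷ []
      C = eval (loopBody tester) (loopEnv (suc u)) [] μ
      k = u ℕ.* iterationCost ℕ.+ 9
      eq : 29 ℕ.+ (Tₙ ℕ.* cost ℕ.+ (10 ℕ.+ k)) ≡ suc u ℕ.* iterationCost ℕ.+ 9
      eq = solve 2 (λ x y → con 29 :+ (x :+ (con 10 :+ (y :+ con 9))) := con 39 :+ x :+ y :+ con 9) ≡.refl
             (Tₙ ℕ.* cost) (u ℕ.* iterationCost)

    test-runs : Runs (9 ℕ.+ (m ℕ.* iterationCost ℕ.+ 9)) (runMixingTest (mixingTest tester) M t ε δ)
                     (acceptance m (ℕ.n<1+n m))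
    test-runs = loop-runs m (ℕ.n<1+n m) []

    accepting≤1 : ∀ u → accepting u ≤ 1#
    accepting≤1 u = ≤-respʳ-≈ (accepting+rejecting u) (x≤x+y (rejecting-nonNeg u))

    acceptance-nonNeg : ∀ u u<n → 0# ≤ acceptance u u<n
    acceptance-nonNeg zero    u<n = 0≤1
    acceptance-nonNeg (suc u) u<n = *-nonNeg (accepting-nonNeg _) (acceptance-nonNeg u _)

    acceptance≤ : ∀ u u<n → acceptance (suc u) u<n ≤ acceptance u (ℕ.<⇒≤ u<n)
    acceptance≤ u u<n = begin
      accepting _ * acceptance u _  ≤⟨ *-monoʳ-≤ _ (acceptance-nonNeg u _) (accepting≤1 _) ⟩
      1# * acceptance u _           ≈⟨ *-identityˡ _ ⟩
      acceptance u _                ∎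

    acceptance≤1 : ∀ u u<n → acceptance u u<n ≤ 1#
    acceptance≤1 zero    u<n = ≤-refl
    acceptance≤1 (suc u) u<n = ≤-trans (acceptance≤ u u<n) (acceptance≤1 u _)

    -- The union bound in product form: replacing the factor 1 of `A` by `a + d` adds `d * A` to
    -- `a * A`, and this is at most `d` since `A` is at most 1.
    acceptance-lower : (∀ i → 1# ≤ accepting i + d) → ∀ u u<n → 1# ≤ acceptance u u<n + fromℕ u * d
    acceptance-lower accepts zero    u<n = x≤x+y (*-nonNeg ≤-refl (proj₁ 0<d))
    acceptance-lower accepts (suc u) u<n = begin
      1#                               ≤⟨ acceptance-lower accepts u _ ⟩
      A + fromℕ u * d                  ≈⟨ +-congʳ (*-identityˡ A) ⟨
      1# * A + fromℕ u * d             ≤⟨ +-monoˡ-≤ _ (*-monoʳ-≤ A (acceptance-nonNeg u _) (accepts _)) ⟩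
      (a + d) * A + fromℕ u * d        ≈⟨ +-congʳ (distribʳ A a d) ⟩
      a * A + d * A + fromℕ u * d      ≤⟨ +-monoˡ-≤ _ (+-mono-≤ ≤-refl (*-monoˡ-≤ d (proj₁ 0<d) (acceptance≤1 u _))) ⟩
      a * A + d * 1# + fromℕ u * d     ≈⟨ +-assoc _ _ _ ⟩
      a * A + (d * 1# + fromℕ u * d)   ≈⟨ +-congˡ (+-congʳ (*-comm d 1#)) ⟩
      a * A + (1# * d + fromℕ u * d)   ≈⟨ +-congˡ (distribʳ d 1# (fromℕ u)) ⟨
      a * A + fromℕ (suc u) * d        ∎
      where
      A = acceptance u (ℕ.<⇒≤ u<n)
      a = accepting (fromℕ< u<n)

    -- The factor of state `i` is at most `d` and all others are at most 1. Positivity of `i`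
    -- ensures that its factor occurs in the product.
    acceptance-upper : ∀ {i} → accepting i ≤ d → 0 ℕ.< toℕ i → ∀ u u<n → toℕ i ℕ.≤ u → acceptance u u<n ≤ d
    acceptance-upper a≤d 0<i zero u<n i≤0 = contradiction i≤0 (ℕ.<⇒≱ 0<i)
    acceptance-upper {i} a≤d 0<i (suc u) u<n i≤1+u with toℕ i ℕ.≤? u
    ... | yes i≤u = ≤-trans (acceptance≤ u u<n) (acceptance-upper a≤d 0<i u _ i≤u)
    ... | no  i≰u = begin
      accepting v * acceptance u _  ≤⟨ *-monoˡ-≤ _ (accepting-nonNeg v) (acceptance≤1 u _) ⟩
      accepting v * 1#              ≈⟨ *-identityʳ _ ⟩
      accepting v                   ≡⟨ ≡.cong accepting v≡i ⟩
      accepting i                   ≤⟨ a≤d ⟩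
      d                             ∎
      where
      v = fromℕ< u<n
      v≡i : v ≡ i
      v≡i = Fin.toℕ-injective (≡.trans (Fin.toℕ-fromℕ< u<n) (ℕ.≤-antisym (ℕ.≰⇒> i≰u) i≤1+u))

    md+d≈δ : fromℕ m * d + d ≈ δ
    md+d≈δ = begin-equality
      fromℕ m * d + d        ≈⟨ +-comm _ d ⟩
      d + fromℕ m * d        ≈⟨ +-congʳ (*-identityˡ d) ⟨
      1# * d + fromℕ m * d   ≈⟨ distribʳ d 1# (fromℕ m) ⟨
      fromℕ n * d            ≈⟨ *-comm _ d ⟩
      d * fromℕ n            ≈⟨ x/y*y≈x δ (0<fromℕ[1+n] m) ⟩
      δ                      ∎

    accepted : Mixing M (f ε / fromℕ 2) t → 1# - δ < acceptance m (ℕ.n<1+n m)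
    accepted mixing = x<y+z⇒x-z<y (begin-strict
      1#                     ≤⟨ acceptance-lower accurate m _ ⟩
      -- Strictness comes from here: only m = n-1 of the n portions of δ have been spent.
      A + fromℕ m * d        <⟨ x<x+y 0<d ⟩
      A + fromℕ m * d + d    ≈⟨ +-assoc A _ d ⟩
      A + (fromℕ m * d + d)  ≈⟨ +-congˡ md+d≈δ ⟩
      A + δ                  ∎)
      where
      A = acceptance m (ℕ.n<1+n m)
      accurate : ∀ i → 1# ≤ accepting i + d
      accurate i = x-z≤y⇒x≤y+z (accepts 0<ε 0<d d<1 (row-isDistribution i) (row-isDistribution zero)
                     (mixing⇒close {t = t} mixing i zero))

    rejected : ¬ Mixing M ε t → acceptance m (ℕ.n<1+n m) < δ
    rejected ¬mixing = begin-strict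
      acceptance m (ℕ.n<1+n m)  ≤⟨ acceptance-upper accepting≤d 0<i m _ (Fin.toℕ≤pred[n] i) ⟩
      d                         <⟨ x<x+y 0<md ⟩
      d + fromℕ m * d           ≈⟨ +-comm d _ ⟩
      fromℕ m * d + d           ≈⟨ md+d≈δ ⟩
      δ                         ∎
      where
      far = ¬mixing⇒far {t = t} isMarkov ¬mixing zero
      i = proj₁ far

      -- Row 0 has distance 0 from itself, so the far state is not 0. Hence `m` is positive, which
      -- makes `d` strictly smaller than δ.
      0<i : 0 ℕ.< toℕ i
      0<i = ℕ.n≢0⇒n>0 λ i≡0 → <⇒≱ antisym 0<ε (begin
        ε                        ≤⟨ proj₁ (proj₂ far) ⟩
        ‖ row i ⊖ row zero ‖₁    ≡⟨ ≡.cong (λ j → ‖ row j ⊖ row zero ‖₁) (Fin.toℕ-injective {j = zero} i≡0) ⟩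
        ‖ row zero ⊖ row zero ‖₁ ≤⟨ distance-refl (row zero) ⟩
        0#                       ∎)

      0<md : 0# < fromℕ m * d
      0<md = 0<x*y (0<fromℕ (ℕ.≤-trans 0<i (Fin.toℕ≤pred[n] i))) 0<d

      accepting≤d : accepting i ≤ d
      -- The tester bounds the probability of rejection from below; total mass 1 turns this into an
      -- upper bound on acceptance.
      accepting≤d = +-cancelʳ-≤ (Pr Tₙ (comparison i) false) (begin
        accepting i + Pr Tₙ (comparison i) false  ≈⟨ accepting+rejecting i ⟩
        1#                                        ≤⟨ x-z≤y⇒x≤y+z (rejects 0<ε 0<d d<1 (row-isDistribution i) (row-isDistribution zero) (proj₂ far)) ⟩
        Pr Tₙ (comparison i) false + d            ≈⟨ +-comm _ d ⟩
        d + Pr Tₙ (comparison i) false            ∎)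

    -- No configuration decides within zero steps. Positivity lets the product bound absorb the
    -- overhead outside the tester.
    0<Tₙ : 0 ℕ.< Tₙ
    0<Tₙ with Tₙ | decided zero
    ... | suc _ | _ = s≤s z≤n

-- The final time bound and the assembly of the theorem.

-- 73 = 39 + 34 is the cost of one iteration for t = T = 1. The 18 steps outside the iterations fit
-- into the surplus of n over the m iterations.
time-bound : ∀ m t T → 0 ℕ.< t → 0 ℕ.< T →
             9 ℕ.+ (m ℕ.* (39 ℕ.+ T ℕ.* (6 ℕ.+ (t ℕ.* 20 ℕ.+ 8))) ℕ.+ 9) ℕ.≤ 73 ℕ.* (suc m ℕ.* t ℕ.* T)
-- Writing t and T as successors gives the slack natural coefficients, so the inequality becomes a
-- polynomial identity with the slack added on the left.
time-bound m (suc s) (suc r) _ _ = ℕ.m+n≤o⇒m≤o _ (ℕ.≤-reflexive (solve 3 (λ m s r →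
  con 9 :+ (m :* (con 39 :+ (con 1 :+ r) :* (con 6 :+ ((con 1 :+ s) :* con 20 :+ con 8))) :+ con 9)
    :+ (m :* (con 53 :* s :* r :+ con 53 :* s :+ con 39 :* r) :+ con 73 :* (s :* r :+ s :+ r) :+ con 55)
  := con 73 :* ((con 1 :+ m) :* (con 1 :+ s) :* (con 1 :+ r))) ≡.refl m s r))

theorem27 : ∀ {c ℓ₁ ℓ₂} (F : OrderedField c ℓ₁ ℓ₂) →
    let open OrderedField F
        open Testing F
    in
    (f : Carrier → Carrier) (T : ℕ → Carrier → Carrier → ℕ) (tester : Program 5) →
    IsL1Tester f T tester →
    ∃[ test ] ∃[ C ]
      (∀ n .{{_ : NonZero n}} (M : Matrix n) → IsMarkovChain M →
       ∀ t .{{_ : NonZero t}} ε δ → 0# < ε → 0# < δ → δ < 1# →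
       let run = runMixingTest test M t ε δ
           time = C ℕ.* (n ℕ.* t ℕ.* T n ε (δ / fromℕ n))
       in
       DecidesWithin time run
       × (Mixing M (f ε / fromℕ 2) t → (1# - δ) < Pr time run true)
       × (¬ Mixing M ε t → Pr time run true < δ))
theorem27 F f T tester isTester = mixingTest tester , 73 , correct
  where
  open OrderedField F hiding (zero)
  open Testing F
  open OrderedFieldProperties F
  open Execution F
  open TestProgram
  open NonStrictToStrict _≈_ _≤_ using (<-respʳ-≈; <-respˡ-≈)

  correct : ∀ n .{{_ : NonZero n}} (M : Matrix n) → IsMarkovChain M →
    ∀ t .{{_ : NonZero t}} ε δ → 0# < ε → 0# < δ → δ < 1# →
    let run = runMixingTest (mixingTest tester) M t ε δ
        time = 73 ℕ.* (n ℕ.* t ℕ.* T n ε (δ / fromℕ n))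
    in
    DecidesWithin time run
    × (Mixing M (f ε / fromℕ 2) t → (1# - δ) < Pr time run true)
    × (¬ Mixing M ε t → Pr time run true < δ)
  correct n@(suc m) M isMarkov t ε δ 0<ε 0<δ δ<1 =
    proj₁ runs
    , (λ mixing → <-respʳ-≈ sym trans ≤-respʳ-≈ (sym (proj₂ runs)) (accepted mixing))
    , (λ ¬mixing → <-respˡ-≈ trans ≤-respˡ-≈ (sym (proj₂ runs)) (rejected ¬mixing))
    where
    0<d : 0# < δ / fromℕ n
    0<d = 0<x/y 0<δ (0<fromℕ[1+n] m)

    open TestExecution.Correctness F f T tester isTester M isMarkov t ε δ 0<ε 0<d (x<1⇒x/n<1 m 0<δ δ<1)
      using (accepted; rejected; test-runs; 0<Tₙ)

    runs = runs-mono (runMixingTest (mixingTest tester) M t ε δ)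
             (time-bound m t (T n ε (δ / fromℕ n)) (ℕ.>-nonZero⁻¹ t) 0<Tₙ) test-runs
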